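{- Let $\Gamma$ be a CNF and let $C=\{p\}\cup C'$ (with the variable of the literal $p$ not occurring in $C'$) be a clause with $\mathrm{var}(C)\subseteq\mathrm{var}(\Gamma)$ that is a RAT for $p$ with respect to $\Gamma$. Let $\Sigma=\mathrm{NB}^\Gamma_p(C)$ and $n=|\mathrm{var}(\Gamma)|$. Then there exists a $\mathsf{BC}^-$ derivation $(\Gamma_1,\dots,\Gamma_N)$ such that $\Gamma_1=\Gamma$, $C\in\Gamma_N$, every clause of $\Gamma_N$ contains (as a subset) some clause of $\Gamma\cup\{C\}$, and $$N\leq |\Sigma|\,(n+1)+s(\Sigma).$$
   Context: A literal is a propositional variable or its negation; $\overline{p}$ is the complement of $p$. A set of literals is tautological if it contains some $x$ and $\overline{x}$. A clause is a finite nontautological set of literals (read as a disjunction); $\bot$ is the empty clause. A CNF is a finite set of clauses; $\mathrm{var}(\cdot)$ denotes the set of variables occurring in a clause or CNF. Resolution. If $A\cup\{x\}$ and $B\cup\{\overline{x}\}$ are clauses with $x$ a variable not occurring in $A$ or $B$, and $A\cup B$ is a clause, then $A\cup B$ is their resolvent on $x$. A weakening of a clause $A$ is any clause $A\cup B$. A resolution proof of $\Gamma$ is a sequence $(\Gamma_1,\dots,\Gamma_N)$ of CNFs with $\Gamma_1=\Gamma$, $\bot\in\Gamma_N$, and each $\Gamma_{i+1}=\Gamma_i\cup\{C\}$, where $C$ is a resolvent of two clauses of $\Gamma_i$ or a weakening of a clause of $\Gamma_i$; its size is $N$. $\mathrm{size}_{\mathsf{Res}}(\Gamma)$ is the minimum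 size of a resolution proof of $\Gamma$ ($\infty$ if $\Gamma$ is satisfiable). Unit propagation. A unit propagation proof is a resolution proof in which, in each use of the resolution rule, one of the two premises is a clause with a single literal. For a set $L$ of literals, $\Gamma\vdash_1 L$ means that $\Gamma\cup\{\{\overline{q}\} : q\in L\}$ has a unit propagation proof. BC and RAT. A clause $C=\{p\}\cup C'$ (variable of $p$ not in $C'$) is blocked (a BC), respectively a RAT, for $p$ with respect to $\Gamma$ if for every $D\in\Gamma$ of the form $\{\overline{p}\}\cup D'$ (variable of $p$ not in $D'$) the set $C'\cup D'$ is tautological, respectively $\Gamma\vdash_1 C'\cup D'$. $C$ is a BC with respect to $\Gamma$ if it is one for some $p\in C$. A $\mathsf{BC}^-$ derivation from $\Gamma$ is a sequence $(\Gamma_1,\dots,\Gamma_N)$ of CNFs with $\Gamma_1=\Gamma$ in which only variables of $\mathrm{var}(\Gamma)$ occur and each $\Gamma_{i+1}=\Gamma_i\cup\{E\}$, where $E$ is a resolvent of two clauses of $\Gamma_i$, a weakening of a clause of $\Gamma_i$, or a blocked clause with respect to $\Gamma_i$. Nonblocking CNF. For a literal $q$, $\mathrm{proj}_q(\Gamma)=\{D\setminus\{q\} : D\in\Gamma,\ q\in D\}$. For a clause $C$ and $p\in C$, $$\mathrm{NB}^\Gamma_p(C)=\{D\setminus C : D\in\mathrm{proj}_{\overline{p}}(\Gamma)\text{ and }(C\setminus\{p\})\cup D\text{ is nontautological}\}.$$ The function $s$. A partial assignment is identified with the (nontautological) set of literals it makes true; it satisfies a CNF if it intersects every clause of it. A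 partial assignment $\alpha$ minimally satisfies $\Sigma$ if it satisfies $\Sigma$ and no proper subset of $\alpha$ does. Let $\mu(\Sigma)$ be the set of clauses $E$ such that $\overline{E}=\{\overline{q} : q\in E\}$ minimally satisfies $\Sigma$ (the CNF $\Sigma\cup\mu(\Sigma)$ is always unsatisfiable), and let $$s(\Sigma)=|\mu(\Sigma)|+\mathrm{size}_{\mathsf{Res}}(\Sigma\cup\mu(\Sigma)).$$ -}

module Defs where

open import Data.List.Base using (List; []; _∷_; [_]; _++_; map; concatMap; filter; deduplicate; length)
open import Data.List.Membership.Propositional using (_∈_; _∉_; find; lose)
open import Data.List.Membership.Propositional.Properties using (∈-filter⁻)
import Data.List.Membership.Setoid as SetoidMembership
open import Data.List.Relation.Binary.Subset.Propositional using (_⊆_)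
import Data.List.Relation.Binary.Subset.DecPropositional as DecSubset
import Data.List.Membership.DecPropositional as DecMembership
open import Data.List.Relation.Unary.Any using (Any; any?; here; there)
open import Data.Maybe.Base as Maybe using ()
open import Data.Nat.Base using (ℕ; suc; _+_; _≤_)
import Data.Nat.Properties as ℕ
open import Data.Product.Base using (∃-syntax; _×_; _,_; proj₁; proj₂)
open import Data.Sum.Base using (_⊎_)
open import Function.Base using (_∘_; id)
open import Function.Bundles using (_⇔_)
open import Level using (0ℓ)
open import Relation.Binary.Bundles using (Setoid)
open import Relation.Binary.Construct.Add.Supremum.NonStrict _≤_ public using (_≤⁺_)
open import Relation.Binary.Definitions using (Decidable; DecidableEquality)
open import Relation.Binary.PropositionalEquality using (_≡_; refl; cong)
open import Relation.Nullary.Construct.Add.Supremum using (_⁺; ⊤⁺) renaming ([_] to fin) public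
open import Relation.Nullary.Decidable using (Dec; yes; no; map′; ¬?; _×-dec_)
open import Relation.Nullary.Negation using (¬_)

data Literal : Set where
  pos neg : ℕ → Literal

var : Literal → ℕ
var (pos x) = x
var (neg x) = x

infix 9 ~_

~_ : Literal → Literal
~ pos x = neg x
~ neg x = pos x

infix 4 _≟_

_≟_ : DecidableEquality Literal
pos x ≟ pos y = map′ (cong pos) (λ { refl → refl }) (x ℕ.≟ y)
neg x ≟ neg y = map′ (cong neg) (λ { refl → refl }) (x ℕ.≟ y)
pos x ≟ neg y = no λ ()
neg x ≟ pos y = no λ ()

open DecMembership _≟_ using (_∈?_)
open DecSubset _≟_ using (_⊆?_)

-- A finite set is represented by a list of its elements; order and
-- repetitions are irrelevant, so equality of sets is _≐_ rather than _≡_.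
LitSet : Set
LitSet = List Literal

infix 4 _≐_ _≐?_

_≐_ : LitSet → LitSet → Set
K ≐ L = K ⊆ L × L ⊆ K

_≐?_ : Decidable _≐_
K ≐? L = (K ⊆? L) ×-dec (L ⊆? K)

infixl 6 _∖_

_∖_ : LitSet → LitSet → LitSet
K ∖ L = filter (λ q → ¬? (q ∈? L)) K

complement : LitSet → LitSet
complement = map ~_

vars : LitSet → List ℕ
vars = map var

Tautological : LitSet → Set
Tautological L = ∃[ x ] pos x ∈ L × neg x ∈ L

tautological? : ∀ L → Dec (Tautological L)
tautological? L = map′ to from (any? (λ q → (~ q) ∈? L) L)
  where
  to : Any (λ q → (~ q) ∈ L) L → Tautological L
  to h with find h
  ... | pos x , q∈L , ~q∈L = x , q∈L , ~q∈L
  ... | neg x , q∈L , ~q∈L = x , ~q∈L , q∈L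
  from : Tautological L → Any (λ q → (~ q) ∈ L) L
  from (x , x∈L , ~x∈L) = lose x∈L ~x∈L

record Clause : Set where
  constructor clause
  field
    lits    : LitSet
    nontaut : ¬ Tautological lits

open Clause public

CNF : Set
CNF = List Clause

clauseSetoid : Setoid 0ℓ 0ℓ
clauseSetoid = record
  { Carrier       = Clause
  ; _≈_           = λ C D → lits C ≐ lits D
  ; isEquivalence = record
    { refl  = id , id
    ; sym   = λ (f , g) → g , f
    ; trans = λ (f , g) (f′ , g′) → f′ ∘ f , g ∘ g′
    }
  }

open SetoidMembership clauseSetoid public using () renaming (_∈_ to _∈ᶜ_)

∣_∣ : CNF → ℕ
∣ Γ ∣ = length (deduplicate (λ C D → lits C ≐? lits D) Γ)

varsᶠ : CNF → List ℕ
varsᶠ = concatMap (vars ∘ lits)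

varCount : CNF → ℕ
varCount Γ = length (deduplicate ℕ._≟_ (varsᶠ Γ))

⊥ᶜ : Clause
⊥ᶜ = clause [] λ ()

unit : Literal → Clause
unit q = clause [ q ] λ { (_ , here refl , here ()) ; (_ , here _ , there ()) }

_∖ᶜ_ : Clause → LitSet → Clause
D ∖ᶜ L = clause (lits D ∖ L) λ (x , h , k) → nontaut D (x , sub h , sub k)
  where
  sub : ∀ {q} → q ∈ lits D ∖ L → q ∈ lits D
  sub = proj₁ ∘ ∈-filter⁻ (λ q → ¬? (q ∈? L))

_≐_⊎̇_ : Clause → Literal → LitSet → Set
C ≐ p ⊎̇ C′ = lits C ≐ (p ∷ C′) × var p ∉ vars C′

-- E is the resolvent of P and Q on some variable; A ∪ B is a clause because
-- E is one.
Resolvent : Clause → Clause → Clause → Set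
Resolvent P Q E = ∃[ x ] ∃[ A ] ∃[ B ]
  (P ≐ pos x ⊎̇ A) × (Q ≐ neg x ⊎̇ B) × lits E ≐ (A ++ B)

Weakening : Clause → Clause → Set
Weakening A E = ∃[ B ] lits E ≐ (lits A ++ B)

Rule : Set₁
Rule = CNF → Clause → Set

-- Derivation R Γ N Δ: a sequence (Γ₁,…,Γ_N) of CNFs with Γ₁ = Γ and Γ_N = Δ,
-- each Γᵢ₊₁ being Γᵢ ∪ {E} for some E that R allows to be added to Γᵢ.
data Derivation (R : Rule) (Γ : CNF) : ℕ → CNF → Set where
  start : Derivation R Γ 1 Γ
  step  : ∀ {N Δ} E → Derivation R Γ N Δ → R Δ E → Derivation R Γ (suc N) (E ∷ Δ)

Refutation : Rule → CNF → ℕ → Set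
Refutation R Γ N = ∃[ Δ ] Derivation R Γ N Δ × ⊥ᶜ ∈ᶜ Δ

ByResolution ByWeakening ByUnitResolution : Rule
ByResolution     Δ E = ∃[ P ] ∃[ Q ] P ∈ᶜ Δ × Q ∈ᶜ Δ × Resolvent P Q E
ByWeakening      Δ E = ∃[ A ] A ∈ᶜ Δ × Weakening A E
ByUnitResolution Δ E = ∃[ P ] ∃[ Q ] P ∈ᶜ Δ × Q ∈ᶜ Δ × Resolvent P Q E ×
  ((∃[ q ] lits P ≐ [ q ]) ⊎ (∃[ q ] lits Q ≐ [ q ]))

Res UnitProp : Rule
Res      Δ E = ByResolution Δ E ⊎ ByWeakening Δ E
UnitProp Δ E = ByUnitResolution Δ E ⊎ ByWeakening Δ E

infix 4 _⊢₁_

_⊢₁_ : CNF → LitSet → Set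
Γ ⊢₁ L = ∃[ N ] Refutation UnitProp (Γ ++ map unit (complement L)) N

BlockedFor RATFor : CNF → Literal → Clause → Set
BlockedFor Γ p C = ∃[ C′ ] (C ≐ p ⊎̇ C′) ×
  (∀ D D′ → D ∈ᶜ Γ → D ≐ (~ p) ⊎̇ D′ → Tautological (C′ ++ D′))
RATFor Γ p C = ∃[ C′ ] (C ≐ p ⊎̇ C′) ×
  (∀ D D′ → D ∈ᶜ Γ → D ≐ (~ p) ⊎̇ D′ → Γ ⊢₁ (C′ ++ D′))

Blocked : Rule
Blocked Γ C = ∃[ p ] p ∈ lits C × BlockedFor Γ p C

-- Derivations from Γ in BC⁻ are Derivation (BC⁻ Γ) Γ N Δ; the first argument
-- restricts the variables that may occur.
BC⁻ : CNF → Rule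
BC⁻ Γ Δ E = vars (lits E) ⊆ varsᶠ Γ ×
  (ByResolution Δ E ⊎ ByWeakening Δ E ⊎ Blocked Δ E)

proj : Literal → CNF → CNF
proj q Γ = map (_∖ᶜ [ q ]) (filter (λ D → q ∈? lits D) Γ)

NB : CNF → Literal → Clause → CNF
NB Γ p C = map (_∖ᶜ lits C)
  (filter (λ D → ¬? (tautological? ((lits C ∖ [ p ]) ++ lits D))) (proj (~ p) Γ))

Satisfies : LitSet → CNF → Set
Satisfies α Γ = ∀ D → D ∈ᶜ Γ → ∃[ q ] q ∈ α × q ∈ lits D

MinimallySatisfies : LitSet → CNF → Set
MinimallySatisfies α Γ = Satisfies α Γ ×
  (∀ β → β ⊆ α → ¬ (α ⊆ β) → ¬ Satisfies β Γ)

Satisfiable : CNF → Set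
Satisfiable Γ = ∃[ α ] ¬ Tautological α × Satisfies α Γ

-- The complement of a clause is nontautological, hence a partial assignment.
_∈μ_ : Clause → CNF → Set
E ∈μ Σ = MinimallySatisfies (complement (lits E)) Σ

-- ℕ ⁺ is ℕ ∪ {∞}, with ⊤⁺ for ∞.
infixl 6 _+⁺_

_+⁺_ : ℕ → ℕ ⁺ → ℕ ⁺
k +⁺ v = Maybe.map (k +_) v

-- SizeRes Γ v and S Σ v are the graphs of size_Res and s: they say that
-- size_Res(Γ) = v and s(Σ) = v respectively.
data SizeRes (Γ : CNF) : ℕ ⁺ → Set where
  minimum  : ∀ {k} → Refutation Res Γ k →
             (∀ j → Refutation Res Γ j → k ≤ j) → SizeRes Γ (fin k)
  infinite : Satisfiable Γ → SizeRes Γ ⊤⁺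

S : CNF → ℕ ⁺ → Set
S Σ v = ∃[ μΣ ] (∀ E → E ∈ᶜ μΣ ⇔ E ∈μ Σ) ×
        ∃[ r ] SizeRes (Σ ++ μΣ) r × v ≡ ∣ μΣ ∣ +⁺ r

{-# OPTIONS --safe #-}

-- Writing L for the set of literals falsified so far, one step of unit
-- propagation passes from L to L ∪ {~ l} when some D ∈ Γ has D ⊆ {l} ∪ L, and
-- a conflict is some D ⊆ L.  Read backwards this is resolution: weakening D
-- yields L at a conflict, and resolving L ∪ {~ l} with D yields L.  All clauses
-- arising contain the initial L, so the clauses C ∪ G with G ∈ Σ are derived
-- within |Σ|(n + 1) steps.  For E ∈ μ(Σ) the clause C ∪ E is blocked for p:
-- a D ∨ ~p of Γ either clashes with C, or D ∖ C ∈ Σ is hit by the complement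
-- of E.  Now a refutation of Σ ∪ μ(Σ), with C added to each clause, derives C;
-- literals over var(C) or outside var(Γ) are first deleted from its clauses.
module Submission where

open import Defs
open import Data.Empty using (⊥-elim)
open import Data.List.Base using (List; []; _∷_; [_]; _++_; map; filter; deduplicate; length)
open import Data.List.Membership.Propositional using (_∈_; _∉_; find; lose)
open import Data.List.Membership.Propositional.Properties
  using (∈-filter⁺; ∈-filter⁻; ∈-map⁺; ∈-map⁻; ∈-++⁺ˡ; ∈-++⁺ʳ; ∈-++⁻; ∈-concatMap⁺;
         ∈-deduplicate⁺; ∈-deduplicate⁻)
import Data.List.Membership.DecPropositional as DecMembership
import Data.List.Membership.Setoid.Properties as SetoidMembership
open import Data.List.Properties using (filter-notAll; map-∘; map-id-local)
import Data.List.Relation.Binary.Subset.DecPropositional as DecSubset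
open import Data.List.Relation.Binary.Subset.Propositional using (_⊆_)
open import Data.List.Relation.Binary.Subset.Propositional.Properties using (++⁺)
open import Data.List.Relation.Unary.All as All using (All; []; _∷_)
import Data.List.Relation.Unary.All.Properties as All
open import Data.List.Relation.Unary.Any using (any?; here; there)
open import Data.Nat.Base using (ℕ; suc; _+_; _*_; _≤_; z≤n; s≤s)
import Data.Nat.Properties as ℕ
open import Data.Product.Base using (∃-syntax; _×_; _,_; proj₁; proj₂)
open import Data.Sum.Base using (_⊎_; inj₁; inj₂; [_,_]′)
open import Function.Base using (_∘_; id; case_of_)
open import Function.Bundles using (module Equivalence)
import Relation.Binary.Construct.Add.Supremum.NonStrict _≤_ as NonStrict
open import Relation.Binary.PropositionalEquality using (_≡_; refl; sym; trans; cong; subst)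
open import Relation.Nullary.Decidable using (Dec; yes; no; ¬?; _×-dec_; decidable-stable)
open import Relation.Nullary.Negation using (¬_; contradiction)

open DecMembership _≟_ using (_∈?_)
open DecMembership ℕ._≟_ using () renaming (_∈?_ to _∈ᵛ?_)
open DecSubset _≟_ using (_⊆?_)

-- Literals and clauses

~-involutive : ∀ l → ~ ~ l ≡ l
~-involutive (pos x) = refl
~-involutive (neg x) = refl

var-~ : ∀ l → var (~ l) ≡ var l
var-~ (pos x) = refl
var-~ (neg x) = refl

var-≡ : ∀ {k l} → var k ≡ var l → k ≡ l ⊎ k ≡ ~ l
var-≡ {pos x} {pos .x} refl = inj₁ refl
var-≡ {pos x} {neg .x} refl = inj₂ refl
var-≡ {neg x} {pos .x} refl = inj₂ refl
var-≡ {neg x} {neg .x} refl = inj₁ refl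

complement-involutive : ∀ L → complement (complement L) ≡ L
complement-involutive L =
  trans (sym (map-∘ L)) (map-id-local (All.universal ~-involutive L))

∈-complement⁻ : ∀ {q L} → q ∈ complement L → ~ q ∈ L
∈-complement⁻ {L = L} q∈ with r , r∈L , refl ← ∈-map⁻ ~_ q∈ =
  subst (_∈ L) (sym (~-involutive r)) r∈L

∉-vars : ∀ {l L} → l ∉ L → ~ l ∉ L → var l ∉ vars L
∉-vars {l} l∉L ~l∉L v∈ with k , k∈L , eq ← ∈-map⁻ var v∈ with var-≡ {l} {k} eq
... | inj₁ refl = l∉L k∈L
... | inj₂ refl = ~l∉L (subst (_∈ _) (sym (~-involutive k)) k∈L)

clash : ∀ {l L} → l ∈ L → ~ l ∈ L → Tautological L
clash {pos x} h k = x , h , k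
clash {neg x} h k = x , k , h

∷-nontautological : ∀ l {L} → ~ l ∉ L → ¬ Tautological L → ¬ Tautological (l ∷ L)
∷-nontautological (pos _) ~l∉L nt (x , here refl , there k) = ~l∉L k
∷-nontautological (neg _) ~l∉L nt (x , there h , here refl) = ~l∉L h
∷-nontautological l       ~l∉L nt (x , there h , there k)   = nt (x , h , k)

addComplement : ∀ L l → l ∉ lits L → ~ l ∉ lits L → Clause
addComplement L l l∉L ~l∉L = clause (~ l ∷ lits L)
  (∷-nontautological (~ l) (l∉L ∘ subst (_∈ lits L) (~-involutive l)) (nontaut L))

tautological-⊆ : ∀ {K L} → K ⊆ L → Tautological K → Tautological L
tautological-⊆ K⊆L (x , h , k) = x , K⊆L h , K⊆L k

complement-tautological : ∀ {L} → Tautological (complement L) → Tautological L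
complement-tautological (x , h , k) = x , ∈-complement⁻ k , ∈-complement⁻ h

∈-∖⁺ : ∀ {q K L} → q ∈ K → q ∉ L → q ∈ K ∖ L
∈-∖⁺ {L = L} = ∈-filter⁺ (λ q → ¬? (q ∈? L))

∈-∖⁻ : ∀ {q} K L → q ∈ K ∖ L → q ∈ K × q ∉ L
∈-∖⁻ K L = ∈-filter⁻ (λ q → ¬? (q ∈? L)) {xs = K}

∖-remainder : ∀ {p} D → p ∈ lits D → D ≐ p ⊎̇ (lits D ∖ [ p ])
∖-remainder {p} D p∈D = (to , from) , p∉
  where
  to : lits D ⊆ p ∷ (lits D ∖ [ p ])
  to {q} q∈D with q ∈? [ p ]
  ... | yes (here q≡p) = here q≡p
  ... | no q∉ = there (∈-∖⁺ q∈D q∉)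
  from : p ∷ (lits D ∖ [ p ]) ⊆ lits D
  from (here refl) = p∈D
  from (there q∈) = proj₁ (∈-∖⁻ (lits D) [ p ] q∈)
  p∉ : var p ∉ vars (lits D ∖ [ p ])
  p∉ = ∉-vars {L = lits D ∖ [ p ]} (λ p∈ → proj₂ (∈-∖⁻ (lits D) [ p ] p∈) (here refl))
         (λ ~p∈ → nontaut D (clash p∈D (proj₁ (∈-∖⁻ (lits D) [ p ] ~p∈))))

clause-vars : ∀ {D Γ} → D ∈ Γ → vars (lits D) ⊆ varsᶠ Γ
clause-vars D∈Γ v∈ = ∈-concatMap⁺ (vars ∘ lits) (lose D∈Γ v∈)

∈⇒∈ᶜ : ∀ {D Δ} → D ∈ Δ → D ∈ᶜ Δ
∈⇒∈ᶜ D∈Δ = lose D∈Δ (id , id)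

∈ᶜ-⊆ : ∀ {Γ Δ} D → Γ ⊆ Δ → D ∈ᶜ Γ → D ∈ᶜ Δ
∈ᶜ-⊆ D Γ⊆Δ D∈Γ with D₀ , D₀∈Γ , D≐D₀ ← find D∈Γ = lose (Γ⊆Δ D₀∈Γ) D≐D₀

∈ᶜ-≐ : ∀ {D E Δ} → lits D ≐ lits E → E ∈ᶜ Δ → D ∈ᶜ Δ
∈ᶜ-≐ (D⊆E , E⊆D) E∈Δ with F , F∈Δ , E⊆F , F⊆E ← find E∈Δ =
  lose F∈Δ (E⊆F ∘ D⊆E , E⊆D ∘ F⊆E)

distinct : CNF → List Clause
distinct = deduplicate (λ C D → lits C ≐? lits D)

∈ᶜ-distinct : ∀ Γ D → D ∈ᶜ Γ → D ∈ᶜ distinct Γ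
∈ᶜ-distinct Γ D = SetoidMembership.∈-deduplicate⁺ clauseSetoid
  (λ C D → lits C ≐? lits D)
  (λ { (C⊆D , D⊆C) (E⊆D , D⊆E) → D⊆C ∘ E⊆D , D⊆E ∘ C⊆D }) {z = D}

-- Inference rules and derivations

weaken : ∀ {Δ} A E → A ∈ᶜ Δ → lits A ⊆ lits E → ByWeakening Δ E
weaken A E A∈Δ A⊆E =
  A , A∈Δ , lits E , ∈-++⁺ʳ (lits A) , [ A⊆E , id ]′ ∘ ∈-++⁻ (lits A)

-- Inclusions between whole clauses stand in for the remainders `A` and `B`, since inclusions carry
-- over to `lift`. `resolvent⁻` is the converse.
resolvent : ∀ {P Q E x} → pos x ∈ lits P → neg x ∈ lits Q →
  lits P ⊆ pos x ∷ lits E → lits Q ⊆ neg x ∷ lits E →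
  lits E ⊆ lits P ++ lits Q → x ∉ vars (lits E) → Resolvent P Q E
resolvent {P} {Q} {E} {x} x∈P ~x∈Q P⊆ Q⊆ E⊆ x∉E =
  x , _ , _ , ∖-remainder P x∈P , ∖-remainder Q ~x∈Q , to , from
  where
  to : lits E ⊆ (lits P ∖ [ pos x ]) ++ (lits Q ∖ [ neg x ])
  to e∈E with ∈-++⁻ (lits P) (E⊆ e∈E)
  ... | inj₁ e∈P = ∈-++⁺ˡ (∈-∖⁺ e∈P λ { (here refl) → x∉E (∈-map⁺ var e∈E) })
  ... | inj₂ e∈Q = ∈-++⁺ʳ _ (∈-∖⁺ e∈Q λ { (here refl) → x∉E (∈-map⁺ var e∈E) })
  drop : ∀ {l K} → K ⊆ l ∷ lits E → K ∖ [ l ] ⊆ lits E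
  drop {l} {K} K⊆ k∈ with k∈K , k∉ ← ∈-∖⁻ K [ l ] k∈ with K⊆ k∈K
  ... | here k≡l = contradiction (here k≡l) k∉
  ... | there k∈E = k∈E
  from : (lits P ∖ [ pos x ]) ++ (lits Q ∖ [ neg x ]) ⊆ lits E
  from = [ drop P⊆ , drop Q⊆ ]′ ∘ ∈-++⁻ (lits P ∖ [ pos x ])

resolve : ∀ {Δ} P Q E l → P ∈ᶜ Δ → Q ∈ᶜ Δ → l ∈ lits P → ~ l ∈ lits Q →
  lits P ⊆ l ∷ lits E → lits Q ⊆ ~ l ∷ lits E →
  lits E ⊆ lits P ++ lits Q → var l ∉ vars (lits E) → ByResolution Δ E
resolve P Q E (pos x) P∈ Q∈ l∈P ~l∈Q P⊆ Q⊆ E⊆ x∉E =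
  P , Q , P∈ , Q∈ , resolvent {P} {Q} {E} l∈P ~l∈Q P⊆ Q⊆ E⊆ x∉E
resolve P Q E (neg x) P∈ Q∈ l∈P ~l∈Q P⊆ Q⊆ E⊆ x∉E =
  Q , P , Q∈ , P∈ , resolvent {Q} {P} {E} ~l∈Q l∈P Q⊆ P⊆
    ([ ∈-++⁺ʳ (lits Q) , ∈-++⁺ˡ ]′ ∘ ∈-++⁻ (lits P) ∘ E⊆) x∉E

resolvent⁻ : ∀ {P Q E} → Resolvent P Q E → ∃[ x ]
  pos x ∈ lits P × neg x ∈ lits Q ×
  lits P ⊆ pos x ∷ lits E × lits Q ⊆ neg x ∷ lits E ×
  lits E ⊆ lits P ++ lits Q × x ∉ vars (lits E)
resolvent⁻ {P} {Q} {E} (x , A , B , ((P⊆ , ⊆P) , x∉A) , ((Q⊆ , ⊆Q) , x∉B) , E⊆ , ⊆E) =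
  x , ⊆P (here refl) , ⊆Q (here refl) , P⊆′ , Q⊆′ ,
  ++⁺ (⊆P ∘ there) (⊆Q ∘ there) ∘ E⊆ , x∉E
  where
  P⊆′ : lits P ⊆ pos x ∷ lits E
  P⊆′ q∈P with P⊆ q∈P
  ... | here eq = here eq
  ... | there q∈A = there (⊆E (∈-++⁺ˡ q∈A))
  Q⊆′ : lits Q ⊆ neg x ∷ lits E
  Q⊆′ q∈Q with Q⊆ q∈Q
  ... | here eq = here eq
  ... | there q∈B = there (⊆E (∈-++⁺ʳ A q∈B))
  x∉E : x ∉ vars (lits E)
  x∉E x∈ with e , e∈E , refl ← ∈-map⁻ var x∈ with ∈-++⁻ A (E⊆ e∈E)
  ... | inj₁ e∈A = x∉A (∈-map⁺ var e∈A)
  ... | inj₂ e∈B = x∉B (∈-map⁺ var e∈B)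

derivation-All : ∀ {R : Rule} {Q : Clause → Set} {Γ N Δ} →
  (∀ {Δ E} → All Q Δ → R Δ E → Q E) → All Q Γ → Derivation R Γ N Δ → All Q Δ
derivation-All sound QΓ start = QΓ
derivation-All sound QΓ (step E d r) = sound QΔ r ∷ QΔ
  where QΔ = derivation-All sound QΓ d

derivation-map : ∀ {R R′ : Rule} {Γ N Δ} → (∀ {Δ E} → R Δ E → R′ Δ E) →
  Derivation R Γ N Δ → Derivation R′ Γ N Δ
derivation-map f start = start
derivation-map f (step E d r) = step E (derivation-map f d) (f r)

derivation-⊆ : ∀ {R Γ N Δ} → Derivation R Γ N Δ → Γ ⊆ Δ
derivation-⊆ start = id
derivation-⊆ (step E d r) = there ∘ derivation-⊆ d

-- The CNF where the two sequences meet is counted only once.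
derivation-trans : ∀ {R Γ m k Δ Δ′} → Derivation R Γ (suc m) Δ →
  Derivation R Δ k Δ′ → Derivation R Γ (k + m) Δ′
derivation-trans d start = d
derivation-trans d (step E e r) = step E (derivation-trans d e) r

-- Unit propagation

-- With L false, D neither is a conflict nor propagates a new literal.  The case
-- lits D ⊆ L needs no separate clause: it would put every literal into L.
Saturated : LitSet → Clause → Set
Saturated L D = ∀ l → lits D ⊆ l ∷ L → ~ l ∈ L

-- Saturation of the unit premise `[ l ]` puts `~ l` into `L`, so the only literal of `Q` that may
-- be missing from `E` lies in `L` already.
saturated-resolvent : ∀ {L P Q E l} → ∃[ q ] lits P ≐ [ q ] →
  l ∈ lits P → lits Q ⊆ ~ l ∷ lits E →
  Saturated L P → Saturated L Q → Saturated L E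
saturated-resolvent {L} {P} {Q} {E} {l} (q , P⊆ , ⊆P) l∈P Q⊆ satP satQ k E⊆ =
  satQ k Q⊆k∷L
  where
  ~l∈L : ~ l ∈ L
  ~l∈L with here refl ← P⊆ l∈P = satP q λ r∈P → case P⊆ r∈P of λ { (here r≡q) → here r≡q }
  Q⊆k∷L : lits Q ⊆ k ∷ L
  Q⊆k∷L r∈Q with Q⊆ r∈Q
  ... | here refl = there ~l∈L
  ... | there r∈E = E⊆ r∈E

saturated-⊆ : ∀ {L} {D E : Clause} → lits D ⊆ lits E → Saturated L D → Saturated L E
saturated-⊆ D⊆E satD l E⊆ = satD l (E⊆ ∘ D⊆E)

saturated-lookup : ∀ {L D Δ} → All (Saturated L) Δ → D ∈ᶜ Δ → Saturated L D
saturated-lookup {L} {D} satΔ D∈Δ with D₀ , D₀∈Δ , _ , D₀⊆D ← find D∈Δ =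
  saturated-⊆ {L} {D₀} {D} D₀⊆D (All.lookup satΔ D₀∈Δ)

saturated-sound : ∀ {L Δ E} → All (Saturated L) Δ → UnitProp Δ E → Saturated L E
saturated-sound {L} {E = E} satΔ (inj₂ (A , A∈Δ , B , E⊆ , ⊆E)) =
  saturated-⊆ {L} {A} {E} (⊆E ∘ ∈-++⁺ˡ) (saturated-lookup {D = A} satΔ A∈Δ)
saturated-sound {L} {E = E} satΔ (inj₁ (P , Q , P∈Δ , Q∈Δ , res , unitary))
  with x , x∈P , ~x∈Q , P⊆ , Q⊆ , _ ← resolvent⁻ {P} {Q} {E} res
  with satP ← saturated-lookup {D = P} satΔ P∈Δ
  with satQ ← saturated-lookup {D = Q} satΔ Q∈Δ
  with unitary
... | inj₁ unitP = saturated-resolvent {L} {P} {Q} {E} unitP x∈P Q⊆ satP satQ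
... | inj₂ unitQ = saturated-resolvent {L} {Q} {P} {E} unitQ ~x∈Q P⊆ satQ satP

-- Saturation is an invariant of unit propagation. The added units have it because `K ⊆ L` and `L`
-- is nontautological, so the empty clause would inherit it.
saturated⇒⊬₁ : ∀ {Γ K L} → ¬ Tautological L → K ⊆ L → All (Saturated L) Γ → ¬ (Γ ⊢₁ K)
saturated⇒⊬₁ {Γ} {K} {L} ntL K⊆L satΓ (_ , Δ , d , ⊥∈Δ) =
  -- The empty clause lies in every set, so its saturation puts every literal into `L`; the variable
  -- 0 is an arbitrary choice.
  ntL (0 , sat⊥ (neg 0) (λ ()) , sat⊥ (pos 0) λ ())
  where
  units : All (Saturated L) (map unit (complement K))
  units = All.map⁺ (All.tabulate λ {q} q∈ l ⊆l∷L → case ⊆l∷L (here refl) of λ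
    { (here refl) → K⊆L (∈-complement⁻ q∈)
    ; (there q∈L) → ⊥-elim (ntL (clash q∈L (K⊆L (∈-complement⁻ q∈)))) })
  sat⊥ : Saturated L ⊥ᶜ
  sat⊥ = saturated-lookup {D = ⊥ᶜ}
    (derivation-All (λ {_} {E} → saturated-sound {E = E}) (All.++⁺ satΓ units) d) ⊥∈Δ

-- In `propagate` the variable of `l` is new to `L`: adding `~ l` keeps `L` nontautological and uses
-- up one unassigned variable.
data Propagation (Γ : CNF) (L : LitSet) : Set where
  conflict  : ∀ {D} → D ∈ Γ → lits D ⊆ L → Propagation Γ L
  propagate : ∀ {D l} → D ∈ Γ → l ∈ lits D → lits D ⊆ l ∷ L → l ∉ L → ~ l ∉ L → Propagation Γ L
  saturated : All (Saturated L) Γ → Propagation Γ L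

propagation : ∀ Γ L → Propagation Γ L
propagation Γ L with any? (λ D → lits D ⊆? L) Γ
... | yes h with D , D∈Γ , D⊆L ← find h = conflict D∈Γ D⊆L
... | no noConflict with any? (λ D → any? (λ l → (lits D ⊆? l ∷ L) ×-dec ¬? (~ l ∈? L)) (lits D)) Γ
...   | yes h with D , D∈Γ , k ← find h with l , l∈D , D⊆ , ~l∉L ← find k =
  propagate D∈Γ l∈D D⊆ l∉L ~l∉L
  where
  l∉L : l ∉ L
  l∉L l∈L = noConflict (lose D∈Γ λ q∈D → case D⊆ q∈D of λ
    { (here refl) → l∈L ; (there q∈L) → q∈L })
...   | no noUnit = saturated (All.tabulate λ {D} D∈Γ l D⊆ →
  -- Were `~ l` not in `L`, then `D` would propagate `l` if it contains `l` and be a conflict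
  -- otherwise; both are excluded.
  decidable-stable (~ l ∈? L) λ ~l∉L →
  noConflict (lose D∈Γ λ {q} q∈D → case D⊆ q∈D of λ
    { (here refl) → contradiction (lose D∈Γ (lose q∈D ((λ {r} → D⊆ {r}) , ~l∉L))) noUnit
    ; (there q∈L) → q∈L }))

-- Satisfying assignments

-- Avoids constructing a minimal satisfying subset: a smaller satisfying γ ⊆ β is
-- refuted by induction on length, after listing γ as a sublist of β.
⊭-from-minimal : ∀ {Γ α} → (∀ β → β ⊆ α → ¬ MinimallySatisfies β Γ) → ¬ Satisfies α Γ
⊭-from-minimal {Γ} {α} noMin = go (length α) α id ℕ.≤-refl
  where
  go : ∀ f β → β ⊆ α → length β ≤ f → ¬ Satisfies β Γ
  smaller : ∀ f β → β ⊆ α → length β ≤ f → ∀ γ → γ ⊆ β → ¬ β ⊆ γ → ¬ Satisfies γ Γ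
  go f β β⊆α β≤f satβ = noMin β β⊆α (satβ , smaller f β β⊆α β≤f)
  smaller f β β⊆α β≤f γ γ⊆β β⊈γ satγ with All.all? (_∈? γ) β
  ... | yes β⊆γ = β⊈γ (All.lookup β⊆γ)
  ... | no ¬all with ℕ.<-≤-trans (filter-notAll (_∈? γ) β (All.¬All⇒Any¬ (_∈? γ) β ¬all)) β≤f
  ...   | s≤s β′≤f = go _ (filter (_∈? γ) β) (β⊆α ∘ proj₁ ∘ ∈-filter⁻ (_∈? γ)) β′≤f
    λ D D∈Γ → let q , q∈γ , q∈D = satγ D D∈Γ in q , ∈-filter⁺ (_∈? γ) (γ⊆β q∈γ) q∈γ , q∈D

-- If some `β ⊆ α` satisfies `Γ` minimally, its complement is a clause of μ(Γ). As `α` meets that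
-- clause, `α` contains a literal together with its complement.
μ-unsatisfiable : ∀ {Γ μΓ} → (∀ E → E ∈μ Γ → E ∈ᶜ μΓ) → ¬ Satisfiable (Γ ++ μΓ)
μ-unsatisfiable {Γ} {μΓ} complete (α , ntα , satα) = ⊭-from-minimal noMin satΓ
  where
  satΓ : Satisfies α Γ
  satΓ D D∈Γ = satα D (∈ᶜ-⊆ D ∈-++⁺ˡ D∈Γ)
  noMin : ∀ β → β ⊆ α → ¬ MinimallySatisfies β Γ
  noMin β β⊆α min with satα E (∈ᶜ-⊆ E (∈-++⁺ʳ Γ) (complete E E∈μ))
    where
    E : Clause
    E = clause (complement β) (ntα ∘ tautological-⊆ β⊆α ∘ complement-tautological)
    E∈μ : E ∈μ Γ
    E∈μ = subst (λ γ → MinimallySatisfies γ Γ) (sym (complement-involutive β)) min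
  ... | q , q∈α , q∈E = ntα (clash q∈α (β⊆α (∈-complement⁻ q∈E)))

-- Adding C to every clause

∈-NB⁺ : ∀ {Γ D} C p → D ∈ Γ → ~ p ∈ lits D →
  ¬ Tautological ((lits C ∖ [ p ]) ++ (lits D ∖ [ ~ p ])) →
  ((D ∖ᶜ [ ~ p ]) ∖ᶜ lits C) ∈ NB Γ p C
∈-NB⁺ C p D∈Γ ~p∈D nt =
  ∈-map⁺ (_∖ᶜ lits C) (∈-filter⁺ (λ D → ¬? (tautological? ((lits C ∖ [ p ]) ++ lits D)))
    (∈-map⁺ (_∖ᶜ [ ~ p ]) (∈-filter⁺ (λ D → ~ p ∈? lits D) D∈Γ ~p∈D)) nt)

∈-NB⁻ : ∀ {G} Γ C p → G ∈ NB Γ p C → ∃[ D ] D ∈ Γ × ~ p ∈ lits D ×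
  ¬ Tautological ((lits C ∖ [ p ]) ++ (lits D ∖ [ ~ p ])) ×
  G ≡ (D ∖ᶜ [ ~ p ]) ∖ᶜ lits C
∈-NB⁻ Γ C p G∈
  with D₁ , D₁∈ , refl ← ∈-map⁻ (_∖ᶜ lits C) G∈
  with D₁∈proj , nt ← ∈-filter⁻ (λ D → ¬? (tautological? ((lits C ∖ [ p ]) ++ lits D))) {xs = proj (~ p) Γ} D₁∈
  with D , D∈ , refl ← ∈-map⁻ (_∖ᶜ [ ~ p ]) D₁∈proj
  with D∈Γ , ~p∈D ← ∈-filter⁻ (λ D → ~ p ∈? lits D) {xs = Γ} D∈ =
  D , D∈Γ , ~p∈D , nt , refl

module Extension (Γ : CNF) (C : Clause) (C⊆Γ : vars (lits C) ⊆ varsᶠ Γ) where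

  -- Recording that every added clause contains `C` serves twice: for the containment claim of the
  -- theorem, and to show that no added clause contains `~ p` when blockedness is tested.
  BC⁻⊇C : Rule
  BC⁻⊇C Δ E = BC⁻ Γ Δ E × lits C ⊆ lits E

  -- Variables outside `Γ`, which weakening may bring into a refutation, are forbidden in BC⁻;
  -- variables of `C` could make `C ∪ G` tautological. Keeping only free literals makes `lift` total
  -- on clauses.
  Free : Literal → Set
  Free q = var q ∈ varsᶠ Γ × var q ∉ vars (lits C)

  free? : ∀ q → Dec (Free q)
  free? q = (var q ∈ᵛ? varsᶠ Γ) ×-dec ¬? (var q ∈ᵛ? vars (lits C))

  free-~ : ∀ q → Free (~ q) → Free q
  free-~ q = subst (λ x → x ∈ varsᶠ Γ × x ∉ vars (lits C)) (var-~ q)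

  freeLits : Clause → LitSet
  freeLits G = filter free? (lits G)

  lift : Clause → Clause
  lift G = clause (lits C ++ freeLits G) nt
    where
    nt : ¬ Tautological (lits C ++ freeLits G)
    nt (x , h , k) with ∈-++⁻ (lits C) h | ∈-++⁻ (lits C) k
    ... | inj₁ h | inj₁ k = nontaut C (x , h , k)
    ... | inj₁ h | inj₂ k = proj₂ (proj₂ (∈-filter⁻ free? {xs = lits G} k)) (∈-map⁺ var h)
    ... | inj₂ h | inj₁ k = proj₂ (proj₂ (∈-filter⁻ free? {xs = lits G} h)) (∈-map⁺ var k)
    ... | inj₂ h | inj₂ k = nontaut G (x , proj₁ (∈-filter⁻ free? h) , proj₁ (∈-filter⁻ free? k))

  C⊆lift : ∀ G → lits C ⊆ lits (lift G)
  C⊆lift G = ∈-++⁺ˡ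

  lift-free : ∀ {q} G → q ∈ lits G → Free q → q ∈ lits (lift G)
  lift-free G q∈G free = ∈-++⁺ʳ (lits C) (∈-filter⁺ free? q∈G free)

  lift⁻ : ∀ {q} G → q ∈ lits (lift G) → q ∈ lits C ⊎ q ∈ lits G × Free q
  lift⁻ G q∈ with ∈-++⁻ (lits C) q∈
  ... | inj₁ q∈C = inj₁ q∈C
  ... | inj₂ q∈G = inj₂ (∈-filter⁻ free? q∈G)

  lift-vars : ∀ G → vars (lits (lift G)) ⊆ varsᶠ Γ
  lift-vars G v∈ with q , q∈ , refl ← ∈-map⁻ var v∈ with lift⁻ G q∈
  ... | inj₁ q∈C = C⊆Γ (∈-map⁺ var q∈C)
  ... | inj₂ (_ , v∈Γ , _) = v∈Γ

  lift-⊆ : ∀ G {L} → (∀ {q} → q ∈ lits G → Free q → q ∈ L) → lits C ⊆ L →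
    lits (lift G) ⊆ L
  lift-⊆ G G⊆ C⊆ q∈ with lift⁻ G q∈
  ... | inj₁ q∈C = C⊆ q∈C
  ... | inj₂ (q∈G , free) = G⊆ q∈G free

  lift-mono : ∀ {G H} → lits G ⊆ lits H → lits (lift G) ⊆ lits (lift H)
  lift-mono {G} {H} G⊆H = lift-⊆ G (λ q∈G → lift-free H (G⊆H q∈G)) (C⊆lift H)

  -- A resolution on a free variable stays one after lifting. In either case one inference becomes
  -- exactly one, which preserves the size.
  lift-resolution : ∀ {Δ′} P Q E → lift P ∈ᶜ Δ′ → lift Q ∈ᶜ Δ′ → Resolvent P Q E →
    ByResolution Δ′ (lift E) ⊎ ByWeakening Δ′ (lift E)
  lift-resolution P Q E P∈ Q∈ res
    with x , x∈P , ~x∈Q , P⊆ , Q⊆ , E⊆ , x∉E ← resolvent⁻ {P} {Q} {E} res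
    with free? (pos x)
  ... | yes free = inj₁ (resolve (lift P) (lift Q) (lift E) (pos x) P∈ Q∈
      (lift-free P x∈P free) (lift-free Q ~x∈Q free)
      (lift-⊆ P (insert P⊆) (there ∘ C⊆lift E))
      (lift-⊆ Q (insert Q⊆) (there ∘ C⊆lift E))
      (lift-⊆ E E⊆′ (∈-++⁺ˡ ∘ C⊆lift P)) x∉)
    where
    insert : ∀ {K l q} → K ⊆ l ∷ lits E → q ∈ K → Free q → q ∈ l ∷ lits (lift E)
    insert K⊆ q∈K freeq with K⊆ q∈K
    ... | here eq = here eq
    ... | there q∈E = there (lift-free E q∈E freeq)
    E⊆′ : ∀ {q} → q ∈ lits E → Free q → q ∈ lits (lift P) ++ lits (lift Q)
    E⊆′ q∈E freeq with ∈-++⁻ (lits P) (E⊆ q∈E)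
    ... | inj₁ q∈P = ∈-++⁺ˡ (lift-free P q∈P freeq)
    ... | inj₂ q∈Q = ∈-++⁺ʳ (lits (lift P)) (lift-free Q q∈Q freeq)
    x∉ : x ∉ vars (lits (lift E))
    x∉ x∈ with q , q∈ , refl ← ∈-map⁻ var x∈ with lift⁻ E q∈
    ... | inj₁ q∈C = proj₂ free (∈-map⁺ var q∈C)
    ... | inj₂ (q∈E , _) = x∉E (∈-map⁺ var q∈E)
  -- The pivot is deleted from the free part of `P`, so `lift P` is already contained in `lift E`.
  ... | no bound = inj₂ (weaken (lift P) (lift E) P∈ (lift-⊆ P P⊆′ (C⊆lift E)))
    where
    P⊆′ : ∀ {q} → q ∈ lits P → Free q → q ∈ lits (lift E)
    P⊆′ q∈P freeq with P⊆ q∈P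
    ... | here refl = contradiction freeq bound
    ... | there q∈E = lift-free E q∈E freeq

  bc⁻ : ∀ {Δ} E → vars (lits E) ⊆ varsᶠ Γ → lits C ⊆ lits E →
    ByResolution Δ E ⊎ ByWeakening Δ E → BC⁻⊇C Δ E
  bc⁻ E v C⊆E (inj₁ r) = (v , inj₁ r) , C⊆E
  bc⁻ E v C⊆E (inj₂ w) = (v , inj₂ (inj₁ w)) , C⊆E

  lift-derivation : ∀ {Θ N Ξ Δ} → Derivation Res Θ N Ξ →
    (∀ G → G ∈ᶜ Θ → lift G ∈ᶜ Δ) →
    ∃[ Δ′ ] Derivation BC⁻⊇C Δ N Δ′ × (∀ G → G ∈ᶜ Ξ → lift G ∈ᶜ Δ′)
  lift-derivation {Δ = Δ} start lifted = Δ , start , lifted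
  lift-derivation {Ξ = .E ∷ Ξ} (step E d r) lifted with Δ′ , d′ , lifted′ ← lift-derivation d lifted =
    lift E ∷ Δ′ , step (lift E) d′ (bc⁻ (lift E) (lift-vars E) (C⊆lift E) (rule r)) , λ
      { G (here (G⊆E , E⊆G)) → here (lift-mono {G} {E} G⊆E , lift-mono {E} {G} E⊆G)
      ; G (there G∈Ξ) → there (lifted′ G G∈Ξ) }
    where
    rule : Res Ξ E → ByResolution Δ′ (lift E) ⊎ ByWeakening Δ′ (lift E)
    rule (inj₁ (P , Q , P∈Ξ , Q∈Ξ , res)) =
      lift-resolution P Q E (lifted′ P P∈Ξ) (lifted′ Q Q∈Ξ) res
    rule (inj₂ (A , A∈Ξ , B , E⊆ , ⊆E)) =
      inj₂ (weaken (lift A) (lift E) (lifted′ A A∈Ξ) (lift-mono {A} {E} (⊆E ∘ ∈-++⁺ˡ)))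

  -- V covers the variables not yet assigned; its length bounds the recursion.
  derive-⊢₁ : ∀ {Δ K} → Γ ⊆ Δ → Γ ⊢₁ K → ∀ f L V →
    lits C ⊆ lits L → vars (lits L) ⊆ varsᶠ Γ → K ⊆ lits L →
    (∀ {x} → x ∈ varsᶠ Γ → x ∉ vars (lits L) → x ∈ V) → length V ≤ f →
    ∃[ k ] ∃[ Δ′ ] k ≤ suc f × Derivation BC⁻⊇C Δ (suc k) Δ′ × L ∈ᶜ Δ′
  derive-⊢₁ {Δ} Γ⊆Δ ⊢K f L V C⊆L L⊆Γ K⊆L V-covers V≤f with propagation Γ (lits L)
  ... | saturated satΓ = contradiction ⊢K (saturated⇒⊬₁ (nontaut L) K⊆L satΓ)
  -- This weakening is the one step beyond the at most `f` resolutions, hence the bound `suc f`.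
  ... | conflict {D} D∈Γ D⊆L = 1 , L ∷ Δ , s≤s z≤n ,
    step L start (bc⁻ L L⊆Γ C⊆L (inj₂ (weaken D L (∈⇒∈ᶜ (Γ⊆Δ D∈Γ)) D⊆L))) , here (id , id)
  ... | propagate {D} {l} D∈Γ l∈D D⊆ l∉L ~l∉L
    -- The variable of `l` is unassigned and hence listed in `V`; filtering it out strictly shortens
    -- `V`.
    with ℕ.<-≤-trans (filter-notAll (λ x → ¬? (x ℕ.≟ var l)) V
           (lose (V-covers (clause-vars D∈Γ (∈-map⁺ var l∈D)) (∉-vars l∉L ~l∉L)) λ ¬eq → ¬eq refl)) V≤f
  ...   | s≤s {n = f′} V′≤f′
    with derive-⊢₁ Γ⊆Δ ⊢K f′ L′ (filter (λ x → ¬? (x ℕ.≟ var l)) V)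
           (there ∘ C⊆L) L′⊆Γ (there ∘ K⊆L) covers V′≤f′
    where
    L′ = addComplement L l l∉L ~l∉L
    L′⊆Γ : vars (lits L′) ⊆ varsᶠ Γ
    L′⊆Γ (here refl) = subst (_∈ varsᶠ Γ) (sym (var-~ l)) (clause-vars D∈Γ (∈-map⁺ var l∈D))
    L′⊆Γ (there v∈L) = L⊆Γ v∈L
    covers : ∀ {x} → x ∈ varsᶠ Γ → x ∉ vars (lits L′) → x ∈ filter (λ x → ¬? (x ℕ.≟ var l)) V
    covers x∈Γ x∉L′ = ∈-filter⁺ (λ x → ¬? (x ℕ.≟ var l)) (V-covers x∈Γ (x∉L′ ∘ there))
      λ { refl → x∉L′ (here (sym (var-~ l))) }
  ...     | k , Δ′ , k≤ , d , L′∈Δ′ = suc k , L ∷ Δ′ , s≤s k≤ ,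
    step L d (bc⁻ L L⊆Γ C⊆L (inj₁ (resolve D (addComplement L l l∉L ~l∉L) L l
      (∈⇒∈ᶜ (derivation-⊆ d (Γ⊆Δ D∈Γ))) L′∈Δ′ l∈D (here refl) D⊆ id
      (∈-++⁺ʳ (lits D) ∘ there) (∉-vars l∉L ~l∉L)))) , here (id , id)

  -- Blockedness may be lost when clauses are added, so `derive` is required to work from every CNF
  -- already reached, at a cost of at most `b` steps.
  derive-all : ∀ b Gs → (∀ {N Δ} → Derivation BC⁻⊇C Γ N Δ → ∀ G → G ∈ Gs →
      ∃[ k ] ∃[ Δ′ ] k ≤ b × Derivation BC⁻⊇C Δ (suc k) Δ′ × lift G ∈ᶜ Δ′) →
    ∀ {m Δ} → Derivation BC⁻⊇C Γ (suc m) Δ →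
    ∃[ k ] ∃[ Δ′ ] k ≤ length Gs * b × Derivation BC⁻⊇C Γ (suc (k + m)) Δ′ ×
      Δ ⊆ Δ′ × (∀ G → G ∈ᶜ Gs → lift G ∈ᶜ Δ′)
  derive-all b [] derive d = 0 , _ , z≤n , d , id , λ _ ()
  derive-all b (G ∷ Gs) derive {m} d
    with k , Δ₁ , k≤ , e , G∈Δ₁ ← derive d G (here refl)
    with j , Δ₂ , j≤ , e′ , Δ₁⊆Δ₂ , Gs∈Δ₂ ←
      derive-all b Gs (λ d H H∈ → derive d H (there H∈)) (derivation-trans d e) =
    j + k , Δ₂ , subst (_≤ length (G ∷ Gs) * b) (ℕ.+-comm k j) (ℕ.+-mono-≤ k≤ j≤) ,
    subst (λ n → Derivation BC⁻⊇C Γ (suc n) Δ₂) (sym (ℕ.+-assoc j k m)) e′ ,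
    Δ₁⊆Δ₂ ∘ derivation-⊆ e , λ
      { H (here (H⊆G , G⊆H)) → ∈ᶜ-≐ {lift H} {lift G} (lift-mono {H} {G} H⊆G , lift-mono {G} {H} G⊆H)
          (∈ᶜ-⊆ (lift G) Δ₁⊆Δ₂ G∈Δ₁)
      ; H (there H∈Gs) → Gs∈Δ₂ H H∈Gs }

  derived : ∀ {N Δ} → Derivation BC⁻⊇C Γ N Δ → All (λ D → D ∈ Γ ⊎ lits C ⊆ lits D) Δ
  derived = derivation-All (λ _ r → inj₂ (proj₂ r)) (All.tabulate inj₁)

  -- Lifting Σ and μ(Σ), and the derivation of `C`

  module _ (p : Literal) (p∈C : p ∈ lits C) where

    -- Thus `lift G` is all of `C ∪ G`. If `~ q` were in `C`, it would either be `p`, whose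
    -- complement was removed from `D`, or clash with `q`, contrary to the nontautology required in
    -- `NB`.
    NB-free : ∀ {G q} → G ∈ NB Γ p C → q ∈ lits G → Free q
    NB-free {q = q} G∈ q∈G
      with D , D∈Γ , ~p∈D , nt , refl ← ∈-NB⁻ Γ C p G∈
      with q∈D∖ , q∉C ← ∈-∖⁻ (lits D ∖ [ ~ p ]) (lits C) q∈G
      with q∈D , q∉~p ← ∈-∖⁻ (lits D) [ ~ p ] q∈D∖ =
      clause-vars D∈Γ (∈-map⁺ var q∈D) , ∉-vars q∉C ~q∉C
      where
      ~q∉C : ~ q ∉ lits C
      ~q∉C ~q∈C = nt (clash (∈-++⁺ʳ (lits C ∖ [ p ]) q∈D∖)
        (∈-++⁺ˡ (∈-∖⁺ ~q∈C λ { (here refl) → q∉~p (here (sym (~-involutive q))) })))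

    -- The set propagated by the RAT condition for `D` is contained in `C ∪ G`. Listing each
    -- variable of `Γ` once as unassigned gives the bound n + 1.
    derive-NB : RATFor Γ p C → ∀ {N Δ} → Derivation BC⁻⊇C Γ N Δ → ∀ G → G ∈ NB Γ p C →
      ∃[ k ] ∃[ Δ′ ] k ≤ varCount Γ + 1 × Derivation BC⁻⊇C Δ (suc k) Δ′ × lift G ∈ᶜ Δ′
    derive-NB (C′ , ((_ , ⊆C) , _) , rat) d G G∈
      with D , D∈Γ , ~p∈D , _ , refl ← ∈-NB⁻ Γ C p G∈ =
      let k , Δ′ , k≤ , e , L∈ = derive-⊢₁ (derivation-⊆ d)
            (rat D _ (∈⇒∈ᶜ D∈Γ) (∖-remainder D ~p∈D)) (varCount Γ) (lift G)
            (deduplicate ℕ._≟_ (varsᶠ Γ)) (C⊆lift G) (lift-vars G) K⊆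
            (λ x∈ _ → ∈-deduplicate⁺ ℕ._≟_ x∈) ℕ.≤-refl
      in k , Δ′ , subst (k ≤_) (ℕ.+-comm 1 _) k≤ , e , L∈
      where
      K⊆ : C′ ++ (lits D ∖ [ ~ p ]) ⊆ lits (lift G)
      K⊆ {q} q∈ with ∈-++⁻ C′ q∈
      ... | inj₁ q∈C′ = C⊆lift G (⊆C (there q∈C′))
      ... | inj₂ q∈D with q ∈? lits C
      ...   | yes q∈C = C⊆lift G q∈C
      ...   | no q∉C = lift-free G q∈G (NB-free G∈ q∈G)
        where q∈G = ∈-∖⁺ q∈D q∉C

    lift-blocked : ∀ {N Δ} → Derivation BC⁻⊇C Γ N Δ → ∀ E →
      Satisfies (complement (lits E)) (NB Γ p C) → Blocked Δ (lift E)
    lift-blocked d E sat = p , C⊆lift E p∈C , _ , ∖-remainder (lift E) (C⊆lift E p∈C) , taut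
      where
      taut : ∀ D D′ → D ∈ᶜ _ → D ≐ (~ p) ⊎̇ D′ → Tautological ((lits (lift E) ∖ [ p ]) ++ D′)
      taut D D′ D∈Δ ((D⊆ , ⊆D) , _)
        with D₀ , D₀∈Δ , D⊆D₀ , D₀⊆D ← find D∈Δ
        with All.lookup (derived d) D₀∈Δ
      -- A clause added after `Γ` contains `p`, so it cannot contain `~ p` as well.
      ... | inj₂ C⊆D₀ = ⊥-elim (nontaut D (clash (D₀⊆D (C⊆D₀ p∈C)) (⊆D (here refl))))
      ... | inj₁ D₀∈Γ with tautological? ((lits C ∖ [ p ]) ++ (lits D₀ ∖ [ ~ p ]))
      ...   | yes t = tautological-⊆ (++⁺ C∖p⊆ D₀∖⊆D′) t
        where
        C∖p⊆ : lits C ∖ [ p ] ⊆ lits (lift E) ∖ [ p ]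
        C∖p⊆ q∈ with q∈C , q∉p ← ∈-∖⁻ (lits C) [ p ] q∈ = ∈-∖⁺ (C⊆lift E q∈C) q∉p
        D₀∖⊆D′ : lits D₀ ∖ [ ~ p ] ⊆ D′
        D₀∖⊆D′ q∈ with q∈D₀ , q∉ ← ∈-∖⁻ (lits D₀) [ ~ p ] q∈ with D⊆ (D₀⊆D q∈D₀)
        ... | here eq = contradiction (here eq) q∉
        ... | there q∈D′ = q∈D′
      -- Now `D₀` without `~ p` and `C` is a clause of Σ, hit by the complement of `E` in some `q`.
      -- As `~ q` is free, it survives in `lift E` and differs from `p`.
      ...   | no nt
        with G∈ ← ∈-NB⁺ C p D₀∈Γ (D⊆D₀ (⊆D (here refl))) nt
        with q , q∈Ē , q∈G ← sat ((D₀ ∖ᶜ [ ~ p ]) ∖ᶜ lits C) (∈⇒∈ᶜ G∈)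
        with q∈D₀∖ , _ ← ∈-∖⁻ (lits D₀ ∖ [ ~ p ]) (lits C) q∈G
        with q∈D₀ , q∉~p ← ∈-∖⁻ (lits D₀) [ ~ p ] q∈D₀∖
        with D⊆ (D₀⊆D q∈D₀)
      ...     | here eq = contradiction (here eq) q∉~p
      ...     | there q∈D′ = clash (∈-++⁺ʳ (lits (lift E) ∖ [ p ]) q∈D′)
        (∈-++⁺ˡ (∈-∖⁺ (lift-free E (∈-complement⁻ q∈Ē) free~q)
          λ { (here refl) → proj₂ free~q (∈-map⁺ var p∈C) }))
        where
        free~q : Free (~ q)
        free~q = free-~ (~ q) (subst Free (sym (~-involutive q)) (NB-free G∈ q∈G))

    derive-C : RATFor Γ p C → ∀ {μ r} →
      (∀ E → E ∈ μ → Satisfies (complement (lits E)) (NB Γ p C)) →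
      Refutation Res (NB Γ p C ++ μ) r →
      ∃[ N ] ∃[ Δ ] Derivation BC⁻⊇C Γ N Δ × C ∈ᶜ Δ ×
        N ≤ ∣ NB Γ p C ∣ * (varCount Γ + 1) + (∣ μ ∣ + r)
    derive-C rat {μ} {r} satμ (Ξ , refutation , ⊥∈Ξ)
      -- Removing duplicates makes the lengths equal to |Σ| here and |μ| below.
      with a , Δ₁ , a≤ , d₁ , _ , Σ∈Δ₁ ← derive-all (varCount Γ + 1) (distinct (NB Γ p C))
             (λ d G G∈ → derive-NB rat d G (∈-deduplicate⁻ _ (NB Γ p C) G∈)) start
      -- One step per clause: the additions made before it contain `C` and cannot spoil its
      -- blockedness.
      with b , Δ₂ , b≤ , d₂ , Δ₁⊆Δ₂ , μ∈Δ₂ ← derive-all 1 (distinct μ)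
             (λ d E E∈ → 1 , _ , ℕ.≤-refl ,
               step (lift E) start
                 ((lift-vars E , inj₂ (inj₂ (lift-blocked d E (satμ E (∈-deduplicate⁻ _ μ E∈))))) , C⊆lift E) ,
               here (id , id)) d₁
      with Δ₃ , d₃ , Ξ∈Δ₃ ← lift-derivation refutation
             (λ G G∈ → case SetoidMembership.∈-++⁻ clauseSetoid {v = G} (NB Γ p C) G∈ of λ
               { (inj₁ G∈Σ) → ∈ᶜ-⊆ (lift G) Δ₁⊆Δ₂ (Σ∈Δ₁ G (∈ᶜ-distinct (NB Γ p C) G G∈Σ))
               ; (inj₂ G∈μ) → μ∈Δ₂ G (∈ᶜ-distinct μ G G∈μ) })
      = _ , Δ₃ , derivation-trans d₂ d₃ , ∈ᶜ-≐ {C} {lift ⊥ᶜ} (∈-++⁺ˡ , lift⊥⊆C) (Ξ∈Δ₃ ⊥ᶜ ⊥∈Ξ) , bound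
      where
      open ℕ.≤-Reasoning
      lift⊥⊆C : lits (lift ⊥ᶜ) ⊆ lits C
      lift⊥⊆C = lift-⊆ ⊥ᶜ (λ ()) id
      -- Here `a` and `b` count steps, while `r` counts CNFs including the initial one, so no extra
      -- 1 arises.
      bound : r + (b + (a + 0)) ≤ ∣ NB Γ p C ∣ * (varCount Γ + 1) + (∣ μ ∣ + r)
      bound = begin
        r + (b + (a + 0))    ≡⟨ cong (λ c → r + (b + c)) (ℕ.+-identityʳ a) ⟩
        r + (b + a)          ≡⟨ ℕ.+-comm r (b + a) ⟩
        b + a + r            ≡⟨ cong (_+ r) (ℕ.+-comm b a) ⟩
        a + b + r            ≡⟨ ℕ.+-assoc a b r ⟩
        a + (b + r)          ≤⟨ ℕ.+-mono-≤ a≤ (ℕ.+-monoˡ-≤ r (subst (b ≤_) (ℕ.*-identityʳ ∣ μ ∣) b≤)) ⟩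
        ∣ NB Γ p C ∣ * (varCount Γ + 1) + (∣ μ ∣ + r) ∎

theorem4p3 : (Γ : CNF) (C : Clause) (p : Literal) →
    vars (lits C) ⊆ varsᶠ Γ →
    RATFor Γ p C →
    let Σ = NB Γ p C
        n = varCount Γ
    in
    (s : ℕ ⁺) → S Σ s →
    ∃[ N ] ∃[ Δ ]
      Derivation (BC⁻ Γ) Γ N Δ ×
      C ∈ᶜ Δ ×
      (∀ E → E ∈ᶜ Δ → ∃[ D ] D ∈ᶜ (C ∷ Γ) × lits D ⊆ lits E) ×
      fin N ≤⁺ (∣ Σ ∣ * (n + 1)) +⁺ s
theorem4p3 Γ C p C⊆Γ rat _ (μΣ , μΣ-spec , _ , infinite sat , refl) =
  -- The value ∞ would require Σ ∪ μ(Σ) to be satisfiable.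
  contradiction sat (μ-unsatisfiable λ E → Equivalence.from (μΣ-spec E))
theorem4p3 Γ C p C⊆Γ rat@(_ , ((_ , ⊆C) , _) , _) _
  (μΣ , μΣ-spec , _ , minimum refutation _ , refl) =
  let N , Δ , d , C∈Δ , N≤ = derive-C p (⊆C (here refl)) rat
        (λ E E∈μΣ → proj₁ (Equivalence.to (μΣ-spec E) (∈⇒∈ᶜ E∈μΣ))) refutation
  in N , Δ , derivation-map proj₁ d , C∈Δ , contains d , NonStrict.[ N≤ ]
  where
  open Extension Γ C C⊆Γ
  contains : ∀ {N Δ} → Derivation BC⁻⊇C Γ N Δ →
    ∀ E → E ∈ᶜ Δ → ∃[ D ] D ∈ᶜ (C ∷ Γ) × lits D ⊆ lits E
  contains d E E∈Δ with E₀ , E₀∈Δ , E⊆E₀ , E₀⊆E ← find E∈Δ with All.lookup (derived d) E₀∈Δ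
  ... | inj₁ E₀∈Γ = E₀ , ∈⇒∈ᶜ (there E₀∈Γ) , E₀⊆E
  ... | inj₂ C⊆E₀ = C , here (id , id) , E₀⊆E ∘ C⊆E₀
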